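{- Let $d=(d_1,\ldots,d_n)$ be a degree sequence with $\sum_{i} d_i = 2n$. Then $d$ has a bi-unicyclic realization if and only if $d_4 \geq 2$ and $d$ is not the sequence $(2,2,\ldots,2)$ of length $n$ with $n$ odd.
   Context: A degree sequence is a sequence $d=(d_1,\ldots,d_n)$ of integers with $d_i\in\{1,\ldots,n-1\}$ for all $i$, even volume $\sum_i d_i$, and ordered so that $d_1\ge d_2\ge\cdots\ge d_n$. A graph $G$ on vertex set $\{1,\ldots,n\}$ realizes $d$ if $\deg_G(i)=d_i$ for all $i$; all graphs are simple. A graph is bi-unicyclic if it is connected, bipartite, and contains exactly one cycle. -}

module Defs where

open import Data.Bool.Base using (Bool; false; T)
open import Data.Fin.Base as Fin using (Fin; toℕ)
open import Data.Fin.Subset using (Subset; ∣_∣)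
open import Data.Nat.Base using (ℕ; suc; _+_; _∸_; _≤_)
open import Data.Nat.Divisibility using (_∣_)
open import Data.Nat.DivMod using (_mod_)
open import Data.Nat.Properties using (+-0-commutativeMonoid)
open import Data.Product.Base using (Σ-syntax; ∃-syntax; _×_)
open import Data.Sum.Base using (_⊎_)
open import Data.Vec.Base using (tabulate)
open import Data.Vec.Functional using (Vector)
open import Function.Bundles using (_⇔_)
open import Function.Definitions using (Injective)
open import Relation.Binary.Construct.Closure.ReflexiveTransitive using (Star)
open import Relation.Binary.PropositionalEquality.Core using (_≡_; _≢_)

open import Algebra.Properties.CommutativeMonoid.Sum +-0-commutativeMonoid public
  using (sum)

-- The list (d₁, …, dₙ) is 0-indexed here: dᵢ is the entry at the i-th element
-- of Fin n, whose toℕ is i ∸ 1.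
record IsDegreeSequence {n : ℕ} (d : Vector ℕ n) : Set where
  field
    positive   : ∀ i → 1 ≤ d i
    bounded    : ∀ i → d i ≤ n ∸ 1
    evenVolume : 2 ∣ sum d
    decreasing : ∀ {i j} → i Fin.≤ j → d j ≤ d i

record Graph (n : ℕ) : Set where
  field
    adj    : Fin n → Fin n → Bool
    symm   : ∀ u v → adj u v ≡ adj v u
    irrefl : ∀ v → adj v v ≡ false

  Adj : Fin n → Fin n → Set
  Adj u v = T (adj u v)

  neighbours : Fin n → Subset n
  neighbours v = tabulate (adj v)

  degree : Fin n → ℕ
  degree v = ∣ neighbours v ∣

open Graph

Realizes : {n : ℕ} → Graph n → Vector ℕ n → Set
Realizes G d = ∀ i → degree G i ≡ d i

-- Star (Adj G) u v is the type of walks from u to v.  The empty graph is not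
-- excluded here, but it contains no cycle and so is never bi-unicyclic.
Connected : {n : ℕ} → Graph n → Set
Connected G = ∀ u v → Star (Adj G) u v

Bipartite : {n : ℕ} → Graph n → Set
Bipartite {n} G = Σ[ side ∈ (Fin n → Bool) ] (∀ {u v} → Adj G u v → side u ≢ side v)

cyclicSuc : {k : ℕ} → Fin (suc k) → Fin (suc k)
cyclicSuc {k} i = suc (toℕ i) mod suc k

-- A cyclic enumeration of at least three distinct vertices, consecutive ones
-- adjacent.  A cycle, as a subgraph, has several such enumerations (choice of
-- starting point and direction), which SameCycle identifies.
record Cycle {n : ℕ} (G : Graph n) : Set where
  field
    extra       : ℕ
    vertex      : Fin (3 + extra) → Fin n
    distinct    : Injective _≡_ _≡_ vertex
    consecutive : ∀ i → Adj G (vertex i) (vertex (cyclicSuc i))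

  HasEdge : Fin n → Fin n → Set
  HasEdge u v = ∃[ i ] ( (u ≡ vertex i × v ≡ vertex (cyclicSuc i))
                       ⊎ (v ≡ vertex i × u ≡ vertex (cyclicSuc i)) )

SameCycle : {n : ℕ} {G : Graph n} → Cycle G → Cycle G → Set
SameCycle C C′ = ∀ u v → Cycle.HasEdge C u v ⇔ Cycle.HasEdge C′ u v

HasExactlyOneCycle : {n : ℕ} → Graph n → Set
HasExactlyOneCycle G = Σ[ C ∈ Cycle G ] (∀ (C′ : Cycle G) → SameCycle C C′)

record BiUnicyclic {n : ℕ} (G : Graph n) : Set where
  field
    connected   : Connected G
    bipartite   : Bipartite G
    uniqueCycle : HasExactlyOneCycle G

{-# OPTIONS --safe #-}

-- (⇒) A cycle in a bipartite graph is even, so it has at least four vertices,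
-- all of degree at least 2.  In a connected 2-regular graph a cycle visits every
-- vertex, so n is then its (even) length.
-- (⇐) If d is constantly 2, take the n-cycle.  Otherwise d₁ ≥ 3.  Start from a
-- 4-cycle on the first four vertices and attach each later vertex as a leaf to an
-- earlier vertex whose degree is still too small.  One exists, because for
-- 4 ≤ k < n the first k entries of d sum to more than 2k, the sum of the degrees
-- used so far.  At the end all degrees are at most dᵢ and have the same sum 2n.
module Submission where

open import Data.Bool.Base using (Bool; true; false; T; not; _∨_; _xor_; if_then_else_)
open import Data.Bool.Properties using (T-≡; T-∨; ∨-comm; ¬-not; not-¬; not-involutive)
open import Data.Fin.Base as Fin using (Fin; zero; suc; toℕ; fromℕ; fromℕ<; inject₁; opposite)
open import Data.Fin.Induction using (<-weakInduction)
open import Data.Fin.Permutation using (Permutation′; reverse; _⟨$⟩ʳ_; _⟨$⟩ˡ_; inverseˡ; inverseʳ)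
open import Data.Fin.Properties as Fin using (_≟_; toℕ-injective; toℕ-fromℕ; toℕ-fromℕ<; toℕ-inject₁; toℕ<n; fromℕ<-injective; injective⇒≤; opposite-prop; opposite-involutive; any?)
open import Data.Fin.Relation.Unary.Top using (view; ‵fromℕ; ‵inject₁)
open import Data.Fin.Subset using (Subset; _∈_; _⊆_; _∪_; ∣_∣; ⁅_⁆)
open import Data.Fin.Subset.Properties using (∣⁅x⁆∣≡1; p⊆q⇒∣p∣≤∣q∣; x∈p⇒∣p-x∣<∣p∣; x∈p∧x≢y⇒x∈p-y; x∈⁅x⁆; x∈p∪q⁺)
open import Data.Nat.Base using (ℕ; zero; suc; _+_; _*_; _∸_; _≤_; _<_; z≤n; s≤s)
open import Data.Nat.Divisibility using (_∣_; divides; _∣?_)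
open import Data.Nat.DivMod using (_%_; m%n<n; n%n≡0; m<n⇒m%n≡m)
import Data.Nat.Properties as ℕ
open import Data.Product.Base using (∃-syntax; _×_; _,_; proj₁; proj₂)
open import Data.Sum.Base as Sum using (_⊎_; inj₁; inj₂; [_,_]′)
open import Data.Vec.Base using (_∷_; []; tabulate)
open import Data.Vec.Functional using (Vector)
open import Data.Vec.Properties using (lookup∘tabulate; lookup⇒[]=; []=⇒lookup)
open import Function.Base using (_∘_; id; const)
open import Function.Bundles using (_⇔_; mk⇔; Equivalence)
open import Function.Definitions using (Injective)
open import Relation.Binary.Construct.Closure.ReflexiveTransitive using (Star; ε; _◅_; _◅◅_; gmap) renaming (reverse to reverseWalk)
open import Relation.Binary.PropositionalEquality using (_≡_; _≢_; refl; sym; trans; cong; cong₂; subst; subst₂; module ≡-Reasoning)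
open import Relation.Nullary using (¬_; yes; no; contradiction)
open import Relation.Nullary.Decidable using (⌊_⌋; toWitness; fromWitness; decidable-stable)
open import Algebra.Properties.CommutativeMonoid.Sum ℕ.+-0-commutativeMonoid using (sum-permute; ∑-distrib-+; sum-cong-≗)
open import Defs

open Equivalence using (to; from)
open Graph
open Cycle

-- Sums and cardinalities

sum-const : ∀ {n c} {f : Vector ℕ n} → (∀ i → f i ≡ c) → sum f ≡ n * c
sum-const {zero}  f≡c = refl
sum-const {suc n} f≡c = cong₂ _+_ (f≡c zero) (sum-const (f≡c ∘ suc))

sum-mono : ∀ {n} {f g : Vector ℕ n} → (∀ i → f i ≤ g i) → sum f ≤ sum g
sum-mono {zero}  f≤g = z≤n
sum-mono {suc n} f≤g = ℕ.+-mono-≤ (f≤g zero) (sum-mono (f≤g ∘ suc))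

-- A strict inequality at one entry could not be made up at the others. This turns degree bounds
-- with the right total into exact degrees.
sum-≤⇒≡ : ∀ {n} {f g : Vector ℕ n} → (∀ i → f i ≤ g i) → sum f ≡ sum g → ∀ i → f i ≡ g i
sum-≤⇒≡ {suc n} {f} {g} f≤g Σ≡ = λ
  { zero    → head≡
  ; (suc i) → sum-≤⇒≡ (f≤g ∘ suc) tail≡ i }
  where
  head≡ : f zero ≡ g zero
  head≡ = ℕ.≤-antisym (f≤g zero) (ℕ.≮⇒≥ λ f<g →
    ℕ.<⇒≢ (ℕ.+-mono-<-≤ f<g (sum-mono (f≤g ∘ suc))) Σ≡)

  tail≡ : sum (f ∘ suc) ≡ sum (g ∘ suc)
  tail≡ = ℕ.+-cancelˡ-≡ (f zero) _ _ (trans Σ≡ (cong (_+ sum (g ∘ suc)) (sym head≡)))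

-- Contrapositive of `sum-mono`. It serves to find a vertex with spare degree, to which a leaf can
-- be attached.
sum-<⇒∃< : ∀ {n} {f g : Vector ℕ n} → sum f < sum g → ∃[ i ] f i < g i
sum-<⇒∃< {f = f} {g} Σ< with any? (λ i → f i ℕ.<? g i)
... | yes f<g = f<g
... | no  f≮g = contradiction (sum-mono λ i → ℕ.≮⇒≥ (f≮g ∘ (i ,_))) (ℕ.<⇒≱ Σ<)

sum-lower : ∀ {n c} {f : Vector ℕ n} → (∀ i → c ≤ f i) → n * c ≤ sum f
sum-lower {n} {c} c≤f = subst (_≤ _) (sum-const {n} {f = const c} (λ _ → refl)) (sum-mono c≤f)

sum-lower-strict : ∀ {n c} {f : Vector ℕ n} → (∀ i → c ≤ f i) → ∀ j → c < f j → n * c < sum f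
sum-lower-strict c≤f zero    c<f = ℕ.+-mono-<-≤ c<f (sum-lower (c≤f ∘ suc))
sum-lower-strict c≤f (suc j) c<f = ℕ.+-mono-≤-< (c≤f zero) (sum-lower-strict (c≤f ∘ suc) j c<f)

indicator : Bool → ℕ
indicator b = if b then 1 else 0

∣b∷p∣ : ∀ {n} b (p : Subset n) → ∣ b ∷ p ∣ ≡ indicator b + ∣ p ∣
∣b∷p∣ true  p = refl
∣b∷p∣ false p = refl

∣tabulate∣≡sum : ∀ {n} (f : Fin n → Bool) → ∣ tabulate f ∣ ≡ sum (indicator ∘ f)
∣tabulate∣≡sum {zero}  f = refl
∣tabulate∣≡sum {suc n} f =
  trans (∣b∷p∣ (f zero) (tabulate (f ∘ suc))) (cong (indicator (f zero) +_) (∣tabulate∣≡sum (f ∘ suc)))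

∣p∪q∣≤∣p∣+∣q∣ : ∀ {n} (p q : Subset n) → ∣ p ∪ q ∣ ≤ ∣ p ∣ + ∣ q ∣
∣p∪q∣≤∣p∣+∣q∣ []          []          = z≤n
∣p∪q∣≤∣p∣+∣q∣ (true ∷ p)  (true ∷ q)  = s≤s (ℕ.≤-trans (∣p∪q∣≤∣p∣+∣q∣ p q) (ℕ.+-monoʳ-≤ ∣ p ∣ (ℕ.n≤1+n _)))
∣p∪q∣≤∣p∣+∣q∣ (true ∷ p)  (false ∷ q) = s≤s (∣p∪q∣≤∣p∣+∣q∣ p q)
∣p∪q∣≤∣p∣+∣q∣ (false ∷ p) (true ∷ q)  = ℕ.≤-trans (s≤s (∣p∪q∣≤∣p∣+∣q∣ p q)) (ℕ.≤-reflexive (sym (ℕ.+-suc ∣ p ∣ ∣ q ∣)))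
∣p∪q∣≤∣p∣+∣q∣ (false ∷ p) (false ∷ q) = ∣p∪q∣≤∣p∣+∣q∣ p q

one-member : ∀ {n} {p : Subset n} {x} → x ∈ p → 1 ≤ ∣ p ∣
one-member x∈p = ℕ.≤-<-trans z≤n (x∈p⇒∣p-x∣<∣p∣ x∈p)

two-members : ∀ {n} {p : Subset n} {x y} → x ∈ p → y ∈ p → y ≢ x → 2 ≤ ∣ p ∣
two-members x∈p y∈p y≢x =
  ℕ.≤-<-trans (one-member (x∈p∧x≢y⇒x∈p-y y∈p y≢x)) (x∈p⇒∣p-x∣<∣p∣ x∈p)

three-members : ∀ {n} {p : Subset n} {x y z} →
  x ∈ p → y ∈ p → z ∈ p → y ≢ x → z ≢ x → z ≢ y → 3 ≤ ∣ p ∣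
three-members x∈p y∈p z∈p y≢x z≢x z≢y =
  ℕ.≤-<-trans (two-members (x∈p∧x≢y⇒x∈p-y y∈p y≢x) (x∈p∧x≢y⇒x∈p-y z∈p z≢x) z≢y)
              (x∈p⇒∣p-x∣<∣p∣ x∈p)

∈-tabulate⁺ : ∀ {n} {f : Fin n → Bool} {x} → T (f x) → x ∈ tabulate f
∈-tabulate⁺ {f = f} {x} fx = lookup⇒[]= x _ (trans (lookup∘tabulate f x) (to T-≡ fx))

∈-tabulate⁻ : ∀ {n} {f : Fin n → Bool} {x} → x ∈ tabulate f → T (f x)
∈-tabulate⁻ {f = f} {x} x∈ = from T-≡ (trans (sym (lookup∘tabulate f x)) ([]=⇒lookup x∈))

-- Parity

odd : ℕ → Bool
odd zero    = false
odd (suc n) = not (odd n)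

odd-false⇒2∣ : ∀ n → odd n ≡ false → 2 ∣ n
odd-false⇒2∣ zero          _ = divides 0 refl
odd-false⇒2∣ (suc (suc n)) e
  with divides q refl ← odd-false⇒2∣ n (trans (sym (not-involutive (odd n))) e) = divides (suc q) refl

2∣⇒odd-false : ∀ {n} → 2 ∣ n → odd n ≡ false
2∣⇒odd-false (divides q refl) = go q
  where
  go : ∀ q → odd (q * 2) ≡ false
  go zero    = refl
  go (suc q) = trans (not-involutive _) (go q)

-- Cyclic successor

module _ {k : ℕ} where

  toℕ-cyclicSuc : (i : Fin (suc k)) → toℕ (cyclicSuc i) ≡ suc (toℕ i) % suc k
  toℕ-cyclicSuc i = toℕ-fromℕ< (m%n<n (suc (toℕ i)) (suc k))

  cyclicSuc-inject₁ : (i : Fin k) → cyclicSuc (inject₁ i) ≡ suc i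
  cyclicSuc-inject₁ i = toℕ-injective (begin
    toℕ (cyclicSuc (inject₁ i))     ≡⟨ toℕ-cyclicSuc (inject₁ i) ⟩
    suc (toℕ (inject₁ i)) % suc k   ≡⟨ cong (λ j → suc j % suc k) (toℕ-inject₁ i) ⟩
    suc (toℕ i) % suc k             ≡⟨ m<n⇒m%n≡m (s≤s (toℕ<n i)) ⟩
    suc (toℕ i)                     ∎)
    where open ≡-Reasoning

  cyclicSuc-fromℕ : cyclicSuc (fromℕ k) ≡ zero
  cyclicSuc-fromℕ = toℕ-injective (begin
    toℕ (cyclicSuc (fromℕ k))   ≡⟨ toℕ-cyclicSuc (fromℕ k) ⟩
    suc (toℕ (fromℕ k)) % suc k ≡⟨ cong (λ j → suc j % suc k) (toℕ-fromℕ k) ⟩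
    suc k % suc k               ≡⟨ n%n≡0 (suc k) ⟩
    0                           ∎)
    where open ≡-Reasoning

  cyclicSuc-cases : (i : Fin (suc k)) →
    (toℕ (cyclicSuc i) ≡ suc (toℕ i)) ⊎ (toℕ i ≡ k × toℕ (cyclicSuc i) ≡ 0)
  cyclicSuc-cases i with view i
  ... | ‵fromℕ     = inj₂ (toℕ-fromℕ k , cong toℕ cyclicSuc-fromℕ)
  ... | ‵inject₁ j = inj₁ (trans (cong toℕ (cyclicSuc-inject₁ j)) (cong suc (sym (toℕ-inject₁ j))))

  -- Inverse of `cyclicSuc`. Splitting on `zero` instead of subtracting modulo the length lets both
  -- inverse laws follow from the two computation rules of `cyclicSuc`.
  cyclicPred : Fin (suc k) → Fin (suc k)
  cyclicPred zero    = fromℕ k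
  cyclicPred (suc i) = inject₁ i

  cyclicSuc-cyclicPred : (i : Fin (suc k)) → cyclicSuc (cyclicPred i) ≡ i
  cyclicSuc-cyclicPred zero    = cyclicSuc-fromℕ
  cyclicSuc-cyclicPred (suc i) = cyclicSuc-inject₁ i

  cyclicPred-cyclicSuc : (i : Fin (suc k)) → cyclicPred (cyclicSuc i) ≡ i
  cyclicPred-cyclicSuc i with view i
  ... | ‵fromℕ     = cong cyclicPred cyclicSuc-fromℕ
  ... | ‵inject₁ j = cong cyclicPred (cyclicSuc-inject₁ j)

  -- The value at `i` is the value at `zero` flipped `toℕ i` times. One full turn makes `suc k`
  -- flips and returns to the start, so the number of flips is even.
  alternating⇒even : (f : Fin (suc k) → Bool) → (∀ i → f (cyclicSuc i) ≡ not (f i)) → 2 ∣ suc k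
  alternating⇒even f alt = odd-false⇒2∣ (suc k) (xor-fixed (odd (suc k)) (f zero) (begin
    odd (suc k) xor f zero           ≡⟨ not-xor (odd k) (f zero) ⟩
    not (odd k xor f zero)           ≡⟨ cong (λ j → not (odd j xor f zero)) (toℕ-fromℕ k) ⟨
    not (odd (toℕ (fromℕ k)) xor f zero) ≡⟨ cong not (f≡ (fromℕ k)) ⟨
    not (f (fromℕ k))                ≡⟨ alt (fromℕ k) ⟨
    f (cyclicSuc (fromℕ k))          ≡⟨ cong f cyclicSuc-fromℕ ⟩
    f zero                           ∎))
    where
    open ≡-Reasoning

    xor-fixed : ∀ x y → x xor y ≡ y → x ≡ false
    xor-fixed false _     _ = refl
    xor-fixed true  false ()
    xor-fixed true  true  ()

    not-xor : ∀ x y → not x xor y ≡ not (x xor y)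
    not-xor false y = refl
    not-xor true  y = sym (not-involutive y)

    f≡ : ∀ i → f i ≡ odd (toℕ i) xor f zero
    f≡ = <-weakInduction _ refl λ i ih → begin
      f (suc i)                              ≡⟨ cong f (cyclicSuc-inject₁ i) ⟨
      f (cyclicSuc (inject₁ i))              ≡⟨ alt (inject₁ i) ⟩
      not (f (inject₁ i))                    ≡⟨ cong not ih ⟩
      not (odd (toℕ (inject₁ i)) xor f zero) ≡⟨ cong (λ j → not (odd j xor f zero)) (toℕ-inject₁ i) ⟩
      not (odd (toℕ i) xor f zero)           ≡⟨ not-xor (odd (toℕ i)) (f zero) ⟨
      odd (suc (toℕ i)) xor f zero           ∎

cyclicSuc≢ : ∀ {k} (i : Fin (2 + k)) → cyclicSuc i ≢ i
cyclicSuc≢ i e with cyclicSuc-cases i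
... | inj₁ s       = ℕ.1+n≢n (trans (sym s) (cong toℕ e))
... | inj₂ (l , z) with () ← trans (sym l) (trans (cong toℕ (sym e)) z)

-- Two steps without a wrap raise the index by two. Returning to `i` with one wrap would need length
-- 2, and two wraps in a row would need length 1.
cyclicSuc²≢ : ∀ {k} (i : Fin (3 + k)) → cyclicSuc (cyclicSuc i) ≢ i
cyclicSuc²≢ i e with cyclicSuc-cases i | cyclicSuc-cases (cyclicSuc i)
... | inj₁ s       | inj₁ s′ =
  ℕ.m+1+n≢n 1 (trans (cong suc (sym s)) (trans (sym s′) (cong toℕ e)))
... | inj₁ s       | inj₂ (l , z)
  with () ← trans (sym l) (trans s (cong suc (trans (cong toℕ (sym e)) z)))
... | inj₂ (l , z) | inj₁ s′
  with () ← trans (sym l) (trans (cong toℕ (sym e)) (trans s′ (cong suc z)))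
... | inj₂ (l , z) | inj₂ (l′ , z′) with () ← trans (sym z) l′

-- Ensures that the two neighbours of a vertex along a cycle are different, which is where cycle
-- length at least 3 enters.
cyclicSuc≢cyclicPred : ∀ {k} (i : Fin (3 + k)) → cyclicSuc i ≢ cyclicPred i
cyclicSuc≢cyclicPred i e = cyclicSuc²≢ i (trans (cong cyclicSuc e) (cyclicSuc-cyclicPred i))

-- Cycles in graphs

adj-sym : ∀ {n} (G : Graph n) {u v} → Adj G u v → Adj G v u
adj-sym G {u} {v} = subst T (symm G u v)

module _ {n : ℕ} {G : Graph n} (C : Cycle G) where

  length : ℕ
  length = 3 + extra C

  predecessor : ∀ i → Adj G (vertex C i) (vertex C (cyclicPred i))
  predecessor i = adj-sym G
    (subst (Adj G (vertex C (cyclicPred i)) ∘ vertex C) (cyclicSuc-cyclicPred i) (consecutive C (cyclicPred i)))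

  successor≢predecessor : ∀ i → vertex C (cyclicSuc i) ≢ vertex C (cyclicPred i)
  successor≢predecessor i = cyclicSuc≢cyclicPred i ∘ distinct C

  cycle-degree : ∀ i → 2 ≤ degree G (vertex C i)
  cycle-degree i =
    two-members (∈-tabulate⁺ (predecessor i)) (∈-tabulate⁺ (consecutive C i)) (successor≢predecessor i)

  -- A neighbour other than the two along the cycle would be a third one and raise the degree to 3.
  cycle-neighbours : ∀ i → degree G (vertex C i) ≡ 2 → ∀ {w} → Adj G (vertex C i) w →
    (w ≡ vertex C (cyclicSuc i)) ⊎ (w ≡ vertex C (cyclicPred i))
  cycle-neighbours i deg {w} a with w ≟ vertex C (cyclicSuc i) | w ≟ vertex C (cyclicPred i)
  ... | yes e | _     = inj₁ e
  ... | no _  | yes e = inj₂ e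
  ... | no ≢s | no ≢p = contradiction
    (three-members (∈-tabulate⁺ (predecessor i)) (∈-tabulate⁺ (consecutive C i)) (∈-tabulate⁺ a)
      (successor≢predecessor i) ≢p ≢s)
    (ℕ.<⇒≱ (s≤s (ℕ.≤-reflexive deg)))

  hasEdge⇒adj : ∀ {u v} → HasEdge C u v → Adj G u v
  hasEdge⇒adj (i , inj₁ (refl , refl)) = consecutive C i
  hasEdge⇒adj (i , inj₂ (refl , refl)) = adj-sym G (consecutive C i)

  bipartite⇒even-cycle : Bipartite G → 2 ∣ length
  bipartite⇒even-cycle (side , proper) =
    alternating⇒even (side ∘ vertex C) λ i → ¬-not (proper (adj-sym G (consecutive C i)))

  module _ (conn : Connected G) (regular : ∀ v → degree G v ≡ 2) where

    -- A walk that starts on the cycle never leaves it, since each step goes to one of the two cycle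
    -- neighbours. Connectedness then reaches every vertex.
    spanning : ∀ w → ∃[ i ] vertex C i ≡ w
    spanning w = go zero (conn (vertex C zero) w)
      where
      go : ∀ {w} i → Star (Adj G) (vertex C i) w → ∃[ j ] vertex C j ≡ w
      go i ε = i , refl
      go i (a ◅ as) with cycle-neighbours i (regular _) a
      ... | inj₁ refl = go (cyclicSuc i) as
      ... | inj₂ refl = go (cyclicPred i) as

    -- As `C` is arbitrary, all cycles of a connected 2-regular graph have the same edges, namely
    -- all of them. This yields uniqueness for the cycle graph.
    adj⇒hasEdge : ∀ {u v} → Adj G u v → HasEdge C u v
    adj⇒hasEdge {u} a with spanning u
    ... | i , refl with cycle-neighbours i (regular _) a
    ...   | inj₁ e = i , inj₁ (refl , e)
    ...   | inj₂ e = cyclicPred i , inj₂ (e , cong (vertex C) (sym (cyclicSuc-cyclicPred i)))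

    spanning-length : length ≡ n
    spanning-length = ℕ.≤-antisym (injective⇒≤ (distinct C)) (injective⇒≤ {f = proj₁ ∘ spanning} inj)
      where
      inj : Injective _≡_ _≡_ (proj₁ ∘ spanning)
      inj {u} {v} e = trans (sym (proj₂ (spanning u))) (trans (cong (vertex C) e) (proj₂ (spanning v)))

-- Transfer of cycles along induced embeddings

module _ {m n : ℕ} {G : Graph m} {H : Graph n} (φ : Fin m → Fin n)
  (φ-injective : Injective _≡_ _≡_ φ)
  (φ-adj : ∀ u v → adj H (φ u) (φ v) ≡ adj G u v) where

  mapCycle : Cycle G → Cycle H
  mapCycle C = record
    { extra       = extra C
    ; vertex      = φ ∘ vertex C
    ; distinct    = distinct C ∘ φ-injective
    ; consecutive = λ i → subst T (sym (φ-adj _ _)) (consecutive C i)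
    }

  restrictCycle : (D : Cycle H) → (∀ i → ∃[ u ] φ u ≡ vertex D i) → Cycle G
  restrictCycle D image = record
    { extra       = extra D
    ; vertex      = proj₁ ∘ image
    ; distinct    = λ {i} {j} e → distinct D
        (trans (sym (proj₂ (image i))) (trans (cong φ e) (proj₂ (image j))))
    ; consecutive = λ i → subst T (φ-adj _ _)
        (subst₂ (Adj H) (sym (proj₂ (image i))) (sym (proj₂ (image (cyclicSuc i)))) (consecutive D i))
    }

  -- A cycle `D` of `H` lies in the image of `φ`, so it pulls back to a cycle of `G`. That one has
  -- the edges of `C`, and `φ` carries this agreement back to `H`. Used both for attaching a leaf
  -- and for relabelling.
  embedding-uniqueCycle : (∀ (D : Cycle H) i → ∃[ u ] φ u ≡ vertex D i) →
    HasExactlyOneCycle G → HasExactlyOneCycle H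
  embedding-uniqueCycle image (C , unique) = mapCycle C , λ D → same D
    where
    module _ (D : Cycle H) where
      D↾ : Cycle G
      D↾ = restrictCycle D (image D)

      φ-edge : ∀ {u v} → HasEdge D↾ u v → HasEdge D (φ u) (φ v)
      φ-edge (i , inj₁ (refl , refl)) = i , inj₁ (proj₂ (image D i) , proj₂ (image D (cyclicSuc i)))
      φ-edge (i , inj₂ (refl , refl)) = i , inj₂ (proj₂ (image D i) , proj₂ (image D (cyclicSuc i)))

      φ-edge-C : ∀ {u v} → HasEdge C u v → HasEdge (mapCycle C) (φ u) (φ v)
      φ-edge-C (i , inj₁ (refl , refl)) = i , inj₁ (refl , refl)
      φ-edge-C (i , inj₂ (refl , refl)) = i , inj₂ (refl , refl)

      forth : ∀ {x y} → HasEdge (mapCycle C) x y → HasEdge D x y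
      forth (i , inj₁ (refl , refl)) = φ-edge (to (unique D↾ _ _) (i , inj₁ (refl , refl)))
      forth (i , inj₂ (refl , refl)) = φ-edge (to (unique D↾ _ _) (i , inj₂ (refl , refl)))

      back : ∀ {x y} → HasEdge D x y → HasEdge (mapCycle C) x y
      -- The vertices of `D` are images under `φ` only up to the equalities in `image`, hence the
      -- transport.
      back (i , inj₁ (refl , refl)) =
        subst₂ (HasEdge (mapCycle C)) (proj₂ (image D i)) (proj₂ (image D (cyclicSuc i)))
          (φ-edge-C (from (unique D↾ _ _) (i , inj₁ (refl , refl))))
      back (i , inj₂ (refl , refl)) =
        subst₂ (HasEdge (mapCycle C)) (proj₂ (image D (cyclicSuc i))) (proj₂ (image D i))
          (φ-edge-C (from (unique D↾ _ _) (i , inj₂ (refl , refl))))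

      same : SameCycle (mapCycle C) D
      same x y = mk⇔ forth back

-- The cycle graph

module _ (k : ℕ) where

  cycleGraph : Graph (3 + k)
  cycleGraph = record
    { adj    = λ u v → ⌊ cyclicSuc u ≟ v ⌋ ∨ ⌊ cyclicSuc v ≟ u ⌋
    ; symm   = λ u v → ∨-comm ⌊ cyclicSuc u ≟ v ⌋ _
    ; irrefl = loopless
    }
    where
    loopless : ∀ v → ⌊ cyclicSuc v ≟ v ⌋ ∨ ⌊ cyclicSuc v ≟ v ⌋ ≡ false
    loopless v with cyclicSuc v ≟ v
    ... | yes e = contradiction e (cyclicSuc≢ v)
    ... | no _  = refl

  cycleGraph-adj⁺ : ∀ u → Adj cycleGraph u (cyclicSuc u)
  cycleGraph-adj⁺ u = from (T-∨ {⌊ cyclicSuc u ≟ cyclicSuc u ⌋}) (inj₁ (fromWitness {a? = cyclicSuc u ≟ cyclicSuc u} refl))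

  cycleGraph-adj⁻ : ∀ {u v} → Adj cycleGraph u v → (cyclicSuc u ≡ v) ⊎ (cyclicSuc v ≡ u)
  cycleGraph-adj⁻ {u} {v} a =
    Sum.map toWitness toWitness (to (T-∨ {⌊ cyclicSuc u ≟ v ⌋}) a)

  cycleGraph-cycle : Cycle cycleGraph
  cycleGraph-cycle = record
    { extra = k ; vertex = id ; distinct = id ; consecutive = cycleGraph-adj⁺ }

  -- The lower bound holds for any vertex on a cycle. For the upper bound, all neighbours lie in a
  -- union of two singletons.
  cycleGraph-degree : ∀ v → degree cycleGraph v ≡ 2
  cycleGraph-degree v = ℕ.≤-antisym at-most (cycle-degree cycleGraph-cycle v)
    where
    ends : Subset (3 + k)
    ends = ⁅ cyclicSuc v ⁆ ∪ ⁅ cyclicPred v ⁆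

    neighbours⊆ends : neighbours cycleGraph v ⊆ ends
    neighbours⊆ends {w} w∈ with cycleGraph-adj⁻ {v} {w} (∈-tabulate⁻ {f = adj cycleGraph v} w∈)
    ... | inj₁ refl = x∈p∪q⁺ (inj₁ (x∈⁅x⁆ _))
    ... | inj₂ refl =
      x∈p∪q⁺ (inj₂ (subst (λ x → w ∈ ⁅ x ⁆) (sym (cyclicPred-cyclicSuc w)) (x∈⁅x⁆ w)))

    at-most : degree cycleGraph v ≤ 2
    at-most = begin
      degree cycleGraph v                          ≤⟨ p⊆q⇒∣p∣≤∣q∣ neighbours⊆ends ⟩
      ∣ ends ∣                                     ≤⟨ ∣p∪q∣≤∣p∣+∣q∣ ⁅ cyclicSuc v ⁆ ⁅ cyclicPred v ⁆ ⟩
      ∣ ⁅ cyclicSuc v ⁆ ∣ + ∣ ⁅ cyclicPred v ⁆ ∣   ≡⟨ cong₂ _+_ (∣⁅x⁆∣≡1 (cyclicSuc v)) (∣⁅x⁆∣≡1 (cyclicPred v)) ⟩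
      2                                            ∎
      where open ℕ.≤-Reasoning

  cycleGraph-connected : Connected cycleGraph
  cycleGraph-connected u v = reverseWalk (λ {u} {v} → adj-sym cycleGraph {u} {v}) (walk u) ◅◅ walk v
    where
    walk : ∀ v → Star (Adj cycleGraph) zero v
    walk = <-weakInduction _ ε λ i w →
      w ◅◅ subst (Adj cycleGraph (inject₁ i)) (cyclicSuc-inject₁ i) (cycleGraph-adj⁺ (inject₁ i)) ◅ ε

  cycleGraph-bipartite : 2 ∣ 3 + k → Bipartite cycleGraph
  cycleGraph-bipartite even = odd ∘ toℕ , λ {u} {v} a → [ flip u v , flip′ u v ]′ (cycleGraph-adj⁻ a)
    where
    alternates : ∀ u → odd (toℕ (cyclicSuc u)) ≡ not (odd (toℕ u))
    alternates u with cyclicSuc-cases u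
    ... | inj₁ s       = cong odd s
    -- At the wrap the index drops from `2 + k` to 0. This changes parity exactly because `3 + k` is
    -- even.
    ... | inj₂ (l , z) =
      trans (cong odd z) (sym (trans (cong (not ∘ odd) l) (2∣⇒odd-false even)))

    flip : ∀ u v → cyclicSuc u ≡ v → odd (toℕ u) ≢ odd (toℕ v)
    flip u _ refl e = not-¬ (sym e) (alternates u)

    flip′ : ∀ u v → cyclicSuc v ≡ u → odd (toℕ u) ≢ odd (toℕ v)
    flip′ u v s e = flip v u s (sym e)

  cycleGraph-biUnicyclic : 2 ∣ 3 + k → BiUnicyclic cycleGraph
  cycleGraph-biUnicyclic even = record
    { connected   = cycleGraph-connected
    ; bipartite   = cycleGraph-bipartite even
    -- Every cycle here contains every edge, so both inclusions pass through adjacency.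
    ; uniqueCycle = cycleGraph-cycle , λ D u v →
        mk⇔ (edge D ∘ hasEdge⇒adj cycleGraph-cycle) (edge cycleGraph-cycle ∘ hasEdge⇒adj D)
    }
    where
    edge : (D : Cycle cycleGraph) → ∀ {u v} → Adj cycleGraph u v → HasEdge D u v
    edge D = adj⇒hasEdge D cycleGraph-connected cycleGraph-degree

-- Attaching a leaf

module _ {n : ℕ} (G : Graph n) (p : Fin n) where

  -- The leaf is `zero` and the old vertices are shifted by `suc`, so that the adjacency among them
  -- is that of `G` by computation.
  addLeaf : Graph (suc n)
  addLeaf = record { adj = adj⁺ ; symm = symm⁺ ; irrefl = irrefl⁺ }
    where
    adj⁺ : Fin (suc n) → Fin (suc n) → Bool
    adj⁺ zero    zero    = false
    adj⁺ zero    (suc v) = ⌊ p ≟ v ⌋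
    adj⁺ (suc u) zero    = ⌊ p ≟ u ⌋
    adj⁺ (suc u) (suc v) = adj G u v

    symm⁺ : ∀ u v → adj⁺ u v ≡ adj⁺ v u
    symm⁺ zero    zero    = refl
    symm⁺ zero    (suc v) = refl
    symm⁺ (suc u) zero    = refl
    symm⁺ (suc u) (suc v) = symm G u v

    irrefl⁺ : ∀ v → adj⁺ v v ≡ false
    irrefl⁺ zero    = refl
    irrefl⁺ (suc v) = irrefl G v

  leaf-adj : ∀ {v} → Adj addLeaf zero v → v ≡ suc p
  leaf-adj {suc v} a = cong suc (sym (toWitness a))

  leaf-adj⁺ : Adj addLeaf zero (suc p)
  leaf-adj⁺ = fromWitness {a? = p ≟ p} refl

  -- By computation this cardinality is the degree of the leaf, whose own entry in its adjacency row
  -- is `false`.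
  ∣⌊p≟⌋∣≡1 : ∣ tabulate (λ v → ⌊ p ≟ v ⌋) ∣ ≡ 1
  ∣⌊p≟⌋∣≡1 = ℕ.≤-antisym
    (ℕ.≤-trans
      (p⊆q⇒∣p∣≤∣q∣ λ {v} v∈ →
        subst (λ x → v ∈ ⁅ x ⁆) (sym (toWitness {a? = p ≟ v} (∈-tabulate⁻ v∈))) (x∈⁅x⁆ v))
      (ℕ.≤-reflexive (∣⁅x⁆∣≡1 p)))
    (one-member (∈-tabulate⁺ {f = λ v → ⌊ p ≟ v ⌋} leaf-adj⁺))

  addLeaf-degree : ∀ v → degree addLeaf (suc v) ≡ indicator ⌊ p ≟ v ⌋ + degree G v
  addLeaf-degree v = ∣b∷p∣ ⌊ p ≟ v ⌋ (neighbours G v)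

  -- The leaf contributes 1 and its parent gains 1, so a degree sum of twice the number of vertices
  -- stays so.
  addLeaf-sum : sum (degree addLeaf) ≡ 2 + sum (degree G)
  addLeaf-sum = cong₂ _+_ ∣⌊p≟⌋∣≡1 (begin
    sum (degree addLeaf ∘ suc)                                   ≡⟨ sum-cong-≗ addLeaf-degree ⟩
    sum (λ v → indicator ⌊ p ≟ v ⌋ + degree G v)                 ≡⟨ ∑-distrib-+ (λ v → indicator ⌊ p ≟ v ⌋) (degree G) ⟩
    sum (λ v → indicator ⌊ p ≟ v ⌋) + sum (degree G)             ≡⟨ cong (_+ sum (degree G)) (trans (sym (∣tabulate∣≡sum (λ v → ⌊ p ≟ v ⌋))) ∣⌊p≟⌋∣≡1) ⟩
    1 + sum (degree G)                                           ∎)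
    where open ≡-Reasoning

  -- A vertex on a cycle has two different neighbours there, while the leaf is adjacent to `suc p`
  -- only.
  leaf-not-on-cycle : (D : Cycle addLeaf) → ∀ i → vertex D i ≢ zero
  leaf-not-on-cycle D i e = successor≢predecessor D i
    (trans (leaf-adj (fromLeaf (consecutive D i))) (sym (leaf-adj (fromLeaf (predecessor D i)))))
    where
    fromLeaf : ∀ {v} → Adj addLeaf (vertex D i) v → Adj addLeaf zero v
    fromLeaf {v} = subst (λ u → Adj addLeaf u v) e

  addLeaf-biUnicyclic : BiUnicyclic G → BiUnicyclic addLeaf
  addLeaf-biUnicyclic b = record
    { connected   = connected⁺
    ; bipartite   = side⁺ , λ {u} {v} → proper⁺ u v
    ; uniqueCycle = embedding-uniqueCycle {G = G} {H = addLeaf} suc Fin.suc-injective (λ _ _ → refl) image uniqueCycle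
    }
    where
    open BiUnicyclic b

    toParent : ∀ v → Star (Adj addLeaf) v (suc p)
    toParent zero    = leaf-adj⁺ ◅ ε
    toParent (suc v) = gmap suc id (connected v p)

    connected⁺ : Connected addLeaf
    connected⁺ u v = toParent u ◅◅ reverseWalk (λ {u} {v} → adj-sym addLeaf {u} {v}) (toParent v)

    side⁺ : Fin (suc n) → Bool
    side⁺ zero    = not (proj₁ bipartite p)
    side⁺ (suc v) = proj₁ bipartite v

    proper⁺ : ∀ u v → Adj addLeaf u v → side⁺ u ≢ side⁺ v
    proper⁺ zero    (suc v) a e with refl ← leaf-adj {suc v} a = not-¬ refl (sym e)
    proper⁺ (suc u) zero    a e with refl ← leaf-adj {suc u} a = not-¬ refl e
    proper⁺ (suc u) (suc v) a   = proj₂ bipartite a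

    image : (D : Cycle addLeaf) → ∀ i → ∃[ u ] suc u ≡ vertex D i
    image D i with vertex D i in e
    ... | zero  = contradiction e (leaf-not-on-cycle D i)
    ... | suc u = u , refl

-- Relabelling the vertices

module _ {n : ℕ} (π : Permutation′ n) (G : Graph n) where

  relabel : Graph n
  relabel = record
    { adj    = λ u v → adj G (π ⟨$⟩ʳ u) (π ⟨$⟩ʳ v)
    ; symm   = λ u v → symm G _ _
    ; irrefl = λ v → irrefl G _
    }

  -- Written as a sum of indicators, the size of a neighbourhood is invariant under permuting the
  -- summands.
  relabel-degree : ∀ v → degree relabel v ≡ degree G (π ⟨$⟩ʳ v)
  relabel-degree v = begin
    ∣ tabulate (f ∘ (π ⟨$⟩ʳ_)) ∣      ≡⟨ ∣tabulate∣≡sum (f ∘ (π ⟨$⟩ʳ_)) ⟩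
    sum (indicator ∘ f ∘ (π ⟨$⟩ʳ_))   ≡⟨ sum-permute (indicator ∘ f) π ⟨
    sum (indicator ∘ f)               ≡⟨ ∣tabulate∣≡sum f ⟨
    ∣ tabulate f ∣                    ∎
    where
    open ≡-Reasoning
    f : Fin n → Bool
    f = adj G (π ⟨$⟩ʳ v)

  unlabel-adj : ∀ u v → adj relabel (π ⟨$⟩ˡ u) (π ⟨$⟩ˡ v) ≡ adj G u v
  unlabel-adj u v = cong₂ (adj G) (inverseʳ π) (inverseʳ π)

  relabel-biUnicyclic : BiUnicyclic G → BiUnicyclic relabel
  relabel-biUnicyclic b = record
    { connected   = λ u v → subst₂ (Star (Adj relabel)) (inverseˡ π) (inverseˡ π)
        (gmap (π ⟨$⟩ˡ_) (subst T (sym (unlabel-adj _ _))) (connected (π ⟨$⟩ʳ u) (π ⟨$⟩ʳ v)))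
    ; bipartite   = proj₁ bipartite ∘ (π ⟨$⟩ʳ_) , proj₂ bipartite
    -- `relabel` pulls adjacency back along `π`, so `G` embeds into it by the inverse of `π`, which
    -- reaches every vertex.
    ; uniqueCycle = embedding-uniqueCycle {G = G} {H = relabel} (π ⟨$⟩ˡ_)
        (λ e → trans (sym (inverseʳ π)) (trans (cong (π ⟨$⟩ʳ_) e) (inverseʳ π)))
        unlabel-adj
        (λ D i → π ⟨$⟩ʳ vertex D i , inverseˡ π)
        uniqueCycle
    }
    where open BiUnicyclic b

-- The greedy construction

-- The sequence is increasing here, so that the vertex attached last is zero.
greedy : ∀ m (e : Vector ℕ (4 + m)) → (∀ i → 1 ≤ e i) → (∀ {i j} → i Fin.≤ j → e i ≤ e j) →
  (∀ i → m ≤ toℕ i → 2 ≤ e i) → 3 ≤ e (fromℕ (3 + m)) → (4 + m) * 2 ≤ sum e →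
  ∃[ G ] (∀ i → degree G i ≤ e i) × sum (degree G) ≡ (4 + m) * 2 × BiUnicyclic G
-- For `m = 0` the bound `two≤` covers all four indices, so the 4-cycle fits under `e`.
greedy zero e _ _ two≤ _ _ =
  cycleGraph 1 ,
  (λ i → subst (_≤ e i) (sym (cycleGraph-degree 1 i)) (two≤ i z≤n)) ,
  sum-const (cycleGraph-degree 1) ,
  cycleGraph-biUnicyclic 1 (divides 2 refl)
-- The sum hypothesis is a lower bound, not an equality, because cutting off an entry 1 leaves a
-- surplus for the recursive call.
greedy (suc m) e pos inc two≤ top Σ≥ = extend
  (greedy m (e ∘ suc) (pos ∘ suc) (inc ∘ s≤s) (λ i → two≤ (suc i) ∘ s≤s) top (ℕ.<⇒≤ tail-sum))
  where
  -- If `e zero` is at least 2, so are all later entries, and the last is at least 3. Otherwise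
  -- removing `e zero` costs at most 1, while the required total falls by 2.
  tail-sum : (4 + m) * 2 < sum (e ∘ suc)
  tail-sum with 2 ℕ.≤? e zero
  ... | yes 2≤e = sum-lower-strict (λ i → ℕ.≤-trans 2≤e (inc {zero} {suc i} z≤n)) (fromℕ (3 + m)) top
  ... | no  2≰e = ℕ.+-cancelˡ-≤ 1 _ _ (ℕ.≤-trans Σ≥ (ℕ.+-monoˡ-≤ (sum (e ∘ suc)) (ℕ.≤-pred (ℕ.≰⇒> 2≰e))))

  extend : ∃[ G ] (∀ i → degree G i ≤ e (suc i)) × sum (degree G) ≡ (4 + m) * 2 × BiUnicyclic G →
    ∃[ G ] (∀ i → degree G i ≤ e i) × sum (degree G) ≡ (5 + m) * 2 × BiUnicyclic G
  extend (G , deg≤ , Σdeg , b)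
    -- The degrees used so far sum to less than the bounds in the tail, so some `p` can take one
    -- more edge.
    with p , deg< ← sum-<⇒∃< (subst (_< sum (e ∘ suc)) (sym Σdeg) tail-sum) =
    addLeaf G p , deg≤⁺ , trans (addLeaf-sum G p) (cong (2 +_) Σdeg) , addLeaf-biUnicyclic G p b
    where
    deg≤⁺ : ∀ i → degree (addLeaf G p) i ≤ e i
    deg≤⁺ zero    = subst (_≤ e zero) (sym (∣⌊p≟⌋∣≡1 G p)) (pos zero)
    deg≤⁺ (suc v) with p ≟ v | addLeaf-degree G p v
    ... | yes refl | deg = subst (_≤ e (suc v)) (sym deg) deg<
    ... | no _     | deg = subst (_≤ e (suc v)) (sym deg) (deg≤ v)

-- The reversed sequence is fed to `greedy` and the vertices are reversed back. The degrees obtained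
-- are at most the prescribed ones with the same total, hence equal to them.
realize : ∀ m (d : Vector ℕ (4 + m)) → IsDegreeSequence d → sum d ≡ (4 + m) * 2 →
  (∀ i → toℕ i ≡ 3 → 2 ≤ d i) → 3 ≤ d zero → ∃[ G ] (Realizes G d × BiUnicyclic G)
realize m d D Σd fourth first =
  reorder (greedy m e (positive ∘ opposite) increasing two≤ top (ℕ.≤-reflexive (sym Σe)))
  where
  open IsDegreeSequence D

  e : Vector ℕ (4 + m)
  e = d ∘ opposite

  Σe : sum e ≡ (4 + m) * 2
  Σe = trans (sym (sum-permute d reverse)) Σd

  opposite-anti : ∀ {i j : Fin (4 + m)} → i Fin.≤ j → opposite j Fin.≤ opposite i
  opposite-anti {i} {j} i≤j = subst₂ _≤_ (sym (opposite-prop j)) (sym (opposite-prop i))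
    (ℕ.∸-monoʳ-≤ (4 + m) (s≤s i≤j))

  increasing : ∀ {i j} → i Fin.≤ j → e i ≤ e j
  increasing = decreasing ∘ opposite-anti

  two≤ : ∀ i → m ≤ toℕ i → 2 ≤ e i
  -- An index at least `m` is reversed to one at most 3, where the entry of `d` is at least the
  -- fourth one.
  two≤ i m≤i = ℕ.≤-trans (fourth (suc (suc (suc zero))) refl) (decreasing (begin
    toℕ (opposite i)     ≡⟨ opposite-prop i ⟩
    3 + m ∸ toℕ i        ≤⟨ ℕ.∸-monoʳ-≤ (3 + m) m≤i ⟩
    3 + m ∸ m            ≡⟨ ℕ.m+n∸n≡m 3 m ⟩
    3                    ∎))
    where open ℕ.≤-Reasoning

  top : 3 ≤ e (fromℕ (3 + m))
  top = subst (λ i → 3 ≤ d i) (sym (opposite-involutive zero)) first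

  reorder : ∃[ G ] (∀ i → degree G i ≤ e i) × sum (degree G) ≡ (4 + m) * 2 × BiUnicyclic G →
    ∃[ G ] (Realizes G d × BiUnicyclic G)
  reorder (G , deg≤ , Σdeg , b) = relabel reverse G , realizes , relabel-biUnicyclic reverse G b
    where
    open ≡-Reasoning

    realizes : Realizes (relabel reverse G) d
    realizes i = begin
      degree (relabel reverse G) i   ≡⟨ relabel-degree reverse G i ⟩
      degree G (opposite i)          ≡⟨ sum-≤⇒≡ deg≤ (trans Σdeg (sym Σe)) (opposite i) ⟩
      d (opposite (opposite i))      ≡⟨ cong d (opposite-involutive i) ⟩
      d i                            ∎

-- Necessity of the fourth-degree condition, and the equivalence

four-vertices : ∀ {n} {G : Graph n} (C : Cycle G) → Bipartite G → 4 ≤ length C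
four-vertices C bip with extra C | bipartite⇒even-cycle C bip
-- With no extra vertex the cycle is a triangle, and 3 is not a multiple of 2.
... | zero  | divides (suc zero) ()
... | zero  | divides (suc (suc q)) ()
... | suc _ | _ = s≤s (s≤s (s≤s (s≤s z≤n)))

necessary-fourth : ∀ {n} (d : Vector ℕ n) → IsDegreeSequence d → ∀ {G} → Realizes G d →
  (C : Cycle G) → Bipartite G → ∃[ i ] (toℕ i ≡ 3 × 2 ≤ d i)
necessary-fourth {n} d D {G} real C bip = fourth , toℕ-fromℕ< 3<n , ℕ.≮⇒≥ large
  where
  open IsDegreeSequence D

  3<n : 3 < n
  3<n = ℕ.≤-trans (four-vertices C bip) (injective⇒≤ (distinct C))

  fourth : Fin n
  fourth = fromℕ< 3<n

  large : ¬ (d fourth < 2)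
  -- Cycle vertices have degree at least 2. If the fourth entry were smaller, monotonicity would
  -- confine them all to indices below 3, and at least four vertices would inject into `Fin 3`.
  large d<2 = ℕ.<⇒≱ (four-vertices C bip) (injective⇒≤ {f = λ i → fromℕ< (early i)} λ e →
    distinct C (toℕ-injective (fromℕ<-injective _ _ _ _ e)))
    where
    early : ∀ i → toℕ (vertex C i) < 3
    early i = ℕ.≰⇒> λ 3≤i → ℕ.<⇒≱ d<2 (ℕ.≤-trans
      (subst (2 ≤_) (real (vertex C i)) (cycle-degree C i))
      (decreasing (subst (_≤ toℕ (vertex C i)) (sym (toℕ-fromℕ< 3<n)) 3≤i)))

theorem3p6 : (n : ℕ) (d : Vector ℕ n) → IsDegreeSequence d → sum d ≡ 2 * n →
    (∃[ G ] (Realizes G d × BiUnicyclic G))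
    ⇔
    ((∃[ i ] (toℕ i ≡ 3 × 2 ≤ d i)) × ¬ ((∀ i → d i ≡ 2) × ¬ (2 ∣ n)))
theorem3p6 n d D Σd = mk⇔ necessary (sufficient n d D Σd)
  where
  necessary : ∃[ G ] (Realizes G d × BiUnicyclic G) →
    (∃[ i ] (toℕ i ≡ 3 × 2 ≤ d i)) × ¬ ((∀ i → d i ≡ 2) × ¬ (2 ∣ n))
  necessary (G , real , b) =
    -- If all degrees are 2, the cycle spans the graph, so `n` is its length, which is even by
    -- bipartiteness.
    necessary-fourth d D real C bipartite , λ (all2 , odd-n) →
      odd-n (subst (2 ∣_) (spanning-length C connected (λ v → trans (real v) (all2 v)))
        (bipartite⇒even-cycle C bipartite))
    where
    open BiUnicyclic b
    C = proj₁ uniqueCycle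

  sufficient : ∀ n (d : Vector ℕ n) → IsDegreeSequence d → sum d ≡ 2 * n →
    (∃[ i ] (toℕ i ≡ 3 × 2 ≤ d i)) × ¬ ((∀ i → d i ≡ 2) × ¬ (2 ∣ n)) →
    ∃[ G ] (Realizes G d × BiUnicyclic G)
  sufficient (suc (suc (suc (suc m)))) d D Σd ((i , i≡3 , 2≤d) , not-odd-cycle) with 3 ℕ.≤? d zero
  ... | yes 3≤d = realize m d D (trans Σd (ℕ.*-comm 2 (4 + m)))
    (λ j j≡3 → subst (λ j → 2 ≤ d j) (toℕ-injective (trans i≡3 (sym j≡3))) 2≤d) 3≤d
  -- Now all entries are at most 2 and sum to `2 * n`, so all equal 2. The excluded case gives
  -- evenness of `n` only doubly negated, and decidability of divisibility removes the negations.
  ... | no  3≰d = cycleGraph (suc m) ,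
    (λ v → trans (cycleGraph-degree (suc m) v) (sym (all2 v))) ,
    cycleGraph-biUnicyclic (suc m) (decidable-stable (2 ∣? (4 + m)) λ odd-n → not-odd-cycle (all2 , odd-n))
    where
    all2 : ∀ i → d i ≡ 2
    all2 = sum-≤⇒≡
      (λ i → ℕ.≤-trans (IsDegreeSequence.decreasing D z≤n) (ℕ.≤-pred (ℕ.≰⇒> 3≰d)))
      (trans Σd (trans (ℕ.*-comm 2 (4 + m)) (sym (sum-const {4 + m} {2} (λ _ → refl)))))
  -- With at most three vertices no index equals 3, so the fourth-entry condition is contradictory.
  sufficient (suc (suc (suc zero))) d D Σd ((i , i≡3 , _) , _) =
    contradiction (toℕ<n i) (ℕ.<-irrefl i≡3)
  sufficient (suc (suc zero)) d D Σd ((i , i≡3 , _) , _) =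
    contradiction (ℕ.m<n⇒m<1+n (toℕ<n i)) (ℕ.<-irrefl i≡3)
  sufficient (suc zero) d D Σd ((zero , () , _) , _)
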